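{- Let $n\ge 1$ with $n\not\equiv 1 \pmod 3$, and consider peg solitaire on the triangular board $T_n$. If a sequence of jumps on $T_n$ ends in a board position with exactly one peg, then none of the board positions occurring in this sequence (including the initial one) has $120^\circ$ rotational symmetry, i.e., no such position $P$ satisfies $P(r(h))=P(h)$ for every hole $h$, where $r(x,y)=(y-x,\,n-1-x)$.
   Context: The triangular board $T_n$ is the set of holes with integer skew coordinates $(x,y)$ satisfying $0\le x\le y\le n-1$. A board position $P$ assigns to each hole $h$ either a peg or no peg. A jump takes a peg at hole $p$, jumps it over a peg at an adjacent hole $p+d$ into an empty hole $p+2d$, where $d$ is one of the six directions $(\pm1,0)$, $(0,\pm1)$, $(1,1)$, $(-1,-1)$ and all three holes lie in $T_n$; the jumped-over peg is removed. The map $r(x,y)=(y-x,n-1-x)$ is the counterclockwise rotation of $T_n$ by $120^\circ$ in skew coordinates; a position has $120^\circ$ rotational symmetry if it is invariant under $r$. -}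

module Defs where

open import Data.Bool using (Bool; true; false)
open import Data.Fin using (Fin; suc; inject₁)
open import Data.Integer using (ℤ; +_; -_; _+_; _-_; _*_; _≤_; 0ℤ; 1ℤ; -1ℤ)
open import Data.Integer.Properties using (i≤j⇒0≤j-i; +-monoˡ-≤; +-monoʳ-≤; +-identityʳ; neg-mono-≤; ≤-trans; ≤-reflexive)
open import Data.Nat using (ℕ)
open import Data.Product using (_×_; _,_; proj₁; proj₂; ∃!)
open import Relation.Binary.PropositionalEquality using (_≡_; _≢_)

-- The bounds are irrelevant, so two holes are equal as soon as their
-- coordinates are.
record Hole (n : ℕ) : Set where
  constructor hole
  field
    x y    : ℤ
    .0≤x   : 0ℤ ≤ x
    .x≤y   : x ≤ y
    .y≤n-1 : y ≤ + n - 1ℤ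

coords : ∀ {n} → Hole n → ℤ × ℤ
coords h = Hole.x h , Hole.y h

data Direction : Set where
  +x -x +y -y +xy -xy : Direction

vector : Direction → ℤ × ℤ
vector +x  = 1ℤ , 0ℤ
vector -x  = -1ℤ , 0ℤ
vector +y  = 0ℤ , 1ℤ
vector -y  = 0ℤ , -1ℤ
vector +xy = 1ℤ , 1ℤ
vector -xy = -1ℤ , -1ℤ

step : ℤ → Direction → ℤ × ℤ → ℤ × ℤ
step k d (a , b) = a + k * proj₁ (vector d) , b + k * proj₂ (vector d)

Position : ℕ → Set
Position n = Hole n → Bool

Peg NoPeg : ∀ {n} → Position n → Hole n → Set
Peg   P h = P h ≡ true
NoPeg P h = P h ≡ false

record Jump {n : ℕ} (P Q : Position n) : Set where
  field
    from over to : Hole n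
    direction    : Direction
    over-coords  : coords over ≡ step (+ 1) direction (coords from)
    to-coords    : coords to ≡ step (+ 2) direction (coords from)
    from-before  : Peg P from
    over-before  : Peg P over
    to-before    : NoPeg P to
    from-after   : NoPeg Q from
    over-after   : NoPeg Q over
    to-after     : Peg Q to
    elsewhere    : ∀ h → h ≢ from → h ≢ over → h ≢ to → Q h ≡ P h

-- m jumps, passing through the m + 1 positions P 0, …, P m
IsJumpSequence : ∀ {n} (m : ℕ) → (Fin (ℕ.suc m) → Position n) → Set
IsJumpSequence m P = ∀ (i : Fin m) → Jump (P (inject₁ i)) (P (suc i))

ExactlyOnePeg : ∀ {n} → Position n → Set
ExactlyOnePeg P = ∃! _≡_ (Peg P)

r : ∀ {n} → Hole n → Hole n
r {n} (hole x y 0≤x x≤y y≤n-1) = hole (y - x) (+ n - 1ℤ - x)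
  (i≤j⇒0≤j-i x≤y)
  (+-monoˡ-≤ (- x) y≤n-1)
  (≤-trans (+-monoʳ-≤ (+ n - 1ℤ) (neg-mono-≤ 0≤x)) (≤-reflexive (+-identityʳ (+ n - 1ℤ))))

RotationallySymmetric : ∀ {n} → Position n → Set
RotationallySymmetric P = ∀ h → P (r h) ≡ P h

{-# OPTIONS --safe #-}

-- Give a peg at (x , y) the weight ω^(x + y), where ω generates the
-- multiplicative group of the field F₄ = F₂[ω], and let the mass of a position
-- be the sum of the weights of its pegs.  Three holes in a row have weights v,
-- ωv, ω²v in some order, and 1 + ω + ω² = 0 in characteristic 2, so jumps
-- preserve the mass.  A single peg has mass ω^k ≠ 0.  The rotation multiplies
-- every weight by ω^(n-1) since (y - x) + (n - 1 - x) ≡ (x + y) + (n - 1) mod 3,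
-- so the mass of a symmetric position is fixed by ω^(n-1) ≠ 1 and is therefore 0.
module Submission where

open import Defs
open import Algebra.Bundles using (CommutativeMonoid)
import Algebra.Properties.CommutativeSemigroup as CommutativeSemigroupProperties
open import Data.Bool using (Bool; true; false; _xor_; if_then_else_)
open import Data.Bool.Properties using (xor-assoc; xor-comm; xor-identityʳ; xor-same)
open import Data.Empty using (⊥-elim-irr)
open import Data.Fin using (Fin; zero; suc; fromℕ; fromℕ<; toℕ)
open import Data.Fin.Properties using (toℕ-fromℕ<; toℕ≤pred[n])
open import Data.Integer as ℤ using (ℤ; +_; -[1+_]; +≤+; 0ℤ; 1ℤ; -1ℤ)
import Data.Integer.Properties as ℤ
open import Data.Integer.Tactic.RingSolver using (solve-∀)
open import Data.List using (List; []; _∷_; map; foldr; filter; concatMap; allFin; deduplicate)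
open import Data.List.Membership.Propositional using (_∈_; lose)
open import Data.List.Membership.Propositional.Properties using (∈-map⁺; ∈-concatMap⁺; ∈-allFin; ∈-deduplicate⁺; ∈-filter⁺; ∈-filter⁻)
open import Data.List.Membership.Propositional.Properties.WithK using (unique∧set⇒bag)
open import Data.List.Properties using (map-cong; map-∘)
open import Data.List.Relation.Binary.BagAndSetEquality using (∼bag⇒↭)
open import Data.List.Relation.Binary.Permutation.Propositional using (_↭_; ↭⇒↭ₛ)
import Data.List.Relation.Binary.Permutation.Propositional.Properties as ↭
import Data.List.Relation.Binary.Permutation.Setoid.Properties as ↭ₛ
open import Data.List.Relation.Unary.All using ([]; _∷_)
open import Data.List.Relation.Unary.Any using (here; there)
open import Data.List.Relation.Unary.Unique.Propositional using (Unique; []; _∷_)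
open import Data.List.Relation.Unary.Unique.Propositional.Properties using (map⁺; filter⁺)
import Data.List.Relation.Unary.Unique.DecPropositional.Properties as DecUnique
import Data.List.Membership.DecPropositional as DecMembership
open import Data.Nat as ℕ using (ℕ; zero; suc; _≤_; _%_; s≤s; z≤n)
open import Data.Product using (_×_; _,_; proj₁; proj₂)
open import Function using (_∘_; mk⇔)
open import Level using (0ℓ)
open import Relation.Binary.Definitions using (DecidableEquality)
open import Relation.Binary.PropositionalEquality using (_≡_; _≢_; refl; sym; trans; cong; cong₂; subst; isEquivalence; setoid; module ≡-Reasoning)
open import Relation.Nullary using (¬_; yes; no; contradiction)
open import Relation.Nullary.Decidable using (map′; _×-dec_)

open ≡-Reasoning

-- The field F₄

-- (a , b) stands for a + b ω.
F₄ : Set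
F₄ = Bool × Bool

pattern 𝟎 = false , false
pattern 𝟏 = true , false

infixl 6 _⊕_

_⊕_ : F₄ → F₄ → F₄
(a , b) ⊕ (c , d) = a xor c , b xor d

⊕-commutativeMonoid : CommutativeMonoid 0ℓ 0ℓ
⊕-commutativeMonoid = record
  { _≈_ = _≡_
  ; _∙_ = _⊕_
  ; ε   = 𝟎
  ; isCommutativeMonoid = record
    { isMonoid = record
      { isSemigroup = record
        { isMagma = record { isEquivalence = isEquivalence ; ∙-cong = cong₂ _⊕_ }
        ; assoc   = λ (a , b) (c , d) (e , f) → cong₂ _,_ (xor-assoc a c e) (xor-assoc b d f)
        }
      ; identity = (λ _ → refl) , λ (a , b) → cong₂ _,_ (xor-identityʳ a) (xor-identityʳ b)
      }
    ; comm = λ (a , b) (c , d) → cong₂ _,_ (xor-comm a c) (xor-comm b d)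
    }
  }

open CommutativeMonoid ⊕-commutativeMonoid using () renaming
  (assoc to ⊕-assoc; comm to ⊕-comm; identityʳ to ⊕-identityʳ; isCommutativeMonoid to ⊕-isCommutativeMonoid)
open CommutativeSemigroupProperties (CommutativeMonoid.commutativeSemigroup ⊕-commutativeMonoid)
  using (interchange)

⊕-self : ∀ u → u ⊕ u ≡ 𝟎
⊕-self (a , b) = cong₂ _,_ (xor-same a) (xor-same b)

u⊕v≡𝟎⇒u≡v : ∀ u v → u ⊕ v ≡ 𝟎 → u ≡ v
u⊕v≡𝟎⇒u≡v u v eq = begin
  u           ≡⟨ ⊕-identityʳ u ⟨
  u ⊕ 𝟎       ≡⟨ cong (u ⊕_) (⊕-self v) ⟨
  u ⊕ (v ⊕ v) ≡⟨ ⊕-assoc u v v ⟨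
  u ⊕ v ⊕ v   ≡⟨ cong (_⊕ v) eq ⟩
  v           ∎

-- Since ω² = 1 + ω, the product ω(a + bω) is b + (a + b)ω.
ω· : F₄ → F₄
ω· (a , b) = b , a xor b

ω³≡id : ∀ v → ω· (ω· (ω· v)) ≡ v
ω³≡id (false , false) = refl
ω³≡id (false , true)  = refl
ω³≡id (true  , false) = refl
ω³≡id (true  , true)  = refl

ω·-⊕ : ∀ u v → ω· (u ⊕ v) ≡ ω· u ⊕ ω· v
-- Interchange for `xor` on the second coordinate is read off from `interchange` in `F₄`, with each
-- bit placed on the diagonal.
ω·-⊕ (a , b) (c , d) = cong (b xor d ,_) (cong proj₁ (interchange (a , a) (c , c) (b , b) (d , d)))

ω²·-⊕ : ∀ u v → ω· (ω· (u ⊕ v)) ≡ ω· (ω· u) ⊕ ω· (ω· v)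
ω²·-⊕ u v = trans (cong ω· (ω·-⊕ u v)) (ω·-⊕ (ω· u) (ω· v))

1+ω+ω²≡𝟎 : ∀ v → v ⊕ (ω· v ⊕ ω· (ω· v)) ≡ 𝟎
1+ω+ω²≡𝟎 (false , false) = refl
1+ω+ω²≡𝟎 (false , true)  = refl
1+ω+ω²≡𝟎 (true  , false) = refl
1+ω+ω²≡𝟎 (true  , true)  = refl

1+ω²+ω⁴≡𝟎 : ∀ v → v ⊕ (ω· (ω· v) ⊕ ω· (ω· (ω· (ω· v)))) ≡ 𝟎
1+ω²+ω⁴≡𝟎 v = trans (cong (λ u → v ⊕ (ω· (ω· v) ⊕ u)) (ω³≡id (ω· v)))
  (trans (cong (v ⊕_) (⊕-comm (ω· (ω· v)) (ω· v))) (1+ω+ω²≡𝟎 v))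

ω-fixed : ∀ v → ω· v ≡ v → v ≡ 𝟎
ω-fixed (false , false) _  = refl
ω-fixed (false , true)  ()
ω-fixed (true  , false) ()
ω-fixed (true  , true)  ()

-- Multiplying ω²v = v by ω gives v = ω³v = ωv.
ω²-fixed : ∀ v → ω· (ω· v) ≡ v → v ≡ 𝟎
ω²-fixed v eq = ω-fixed v (trans (sym (cong ω· eq)) (ω³≡id v))

-- Integer powers of ω

infixr 8 ω^_·_

-- ω⁻¹ = ω²
ω^_·_ : ℤ → F₄ → F₄
ω^ + zero       · v = v
ω^ + suc k      · v = ω· (ω^ + k · v)
ω^ -[1+ zero ]  · v = ω· (ω· v)
ω^ -[1+ suc k ] · v = ω· (ω· (ω^ -[1+ k ] · v))

ω^suc : ∀ i v → ω^ (1ℤ ℤ.+ i) · v ≡ ω· (ω^ i · v)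
ω^suc (+ k)        v = refl
ω^suc -[1+ zero ]  v = sym (ω³≡id v)
ω^suc -[1+ suc k ] v = sym (ω³≡id _)

ω^pred : ∀ i v → ω^ (-1ℤ ℤ.+ i) · v ≡ ω· (ω· (ω^ i · v))
ω^pred (+ zero)  v = refl
ω^pred (+ suc k) v = sym (ω³≡id _)
ω^pred -[1+ k ]  v = refl

-- Induction on `i`, peeling off 1 or -1 at a time; `ω^suc` and `ω^pred` absorb the unit whatever
-- the sign of the remaining exponent.
ω^-+ : ∀ i j v → ω^ (i ℤ.+ j) · v ≡ ω^ i · ω^ j · v
ω^-+ (+ zero) j v = cong (ω^_· v) (ℤ.+-identityˡ j)
ω^-+ (+ suc k) j v = begin
  ω^ (+ suc k ℤ.+ j) · v         ≡⟨ cong (ω^_· v) (ℤ.+-assoc 1ℤ (+ k) j) ⟩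
  ω^ (1ℤ ℤ.+ (+ k ℤ.+ j)) · v    ≡⟨ ω^suc (+ k ℤ.+ j) v ⟩
  ω· (ω^ (+ k ℤ.+ j) · v)        ≡⟨ cong ω· (ω^-+ (+ k) j v) ⟩
  ω^ + suc k · ω^ j · v          ∎
ω^-+ -[1+ zero ] j v = ω^pred j v
ω^-+ -[1+ suc k ] j v = begin
  ω^ (-[1+ suc k ] ℤ.+ j) · v          ≡⟨ cong (ω^_· v) (ℤ.+-assoc -1ℤ -[1+ k ] j) ⟩
  ω^ (-1ℤ ℤ.+ (-[1+ k ] ℤ.+ j)) · v    ≡⟨ ω^pred (-[1+ k ] ℤ.+ j) v ⟩
  ω· (ω· (ω^ (-[1+ k ] ℤ.+ j) · v))    ≡⟨ cong (ω· ∘ ω·) (ω^-+ -[1+ k ] j v) ⟩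
  ω^ -[1+ suc k ] · ω^ j · v           ∎

ω^-⊕ : ∀ i u v → ω^ i · (u ⊕ v) ≡ ω^ i · u ⊕ ω^ i · v
ω^-⊕ (+ zero)     u v = refl
ω^-⊕ (+ suc k)    u v = trans (cong ω· (ω^-⊕ (+ k) u v)) (ω·-⊕ (ω^ + k · u) (ω^ + k · v))
ω^-⊕ -[1+ zero ]  u v = ω²·-⊕ u v
ω^-⊕ -[1+ suc k ] u v =
  trans (cong (ω· ∘ ω·) (ω^-⊕ -[1+ k ] u v)) (ω²·-⊕ (ω^ -[1+ k ] · u) (ω^ -[1+ k ] · v))

-- `𝟎 ⊕ 𝟎` computes to `𝟎`, so additivity makes the value a double, which vanishes in characteristic
-- 2.
ω^-𝟎 : ∀ i → ω^ i · 𝟎 ≡ 𝟎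
ω^-𝟎 i = trans (ω^-⊕ i 𝟎 𝟎) (⊕-self (ω^ i · 𝟎))

ω^-nonzero : ∀ i → ω^ i · 𝟏 ≢ 𝟎
ω^-nonzero i eq = contradiction 𝟏≡𝟎 λ ()
  where
  𝟏≡𝟎 : 𝟏 ≡ 𝟎
  𝟏≡𝟎 = begin
    𝟏                        ≡⟨ cong (ω^_· 𝟏) (ℤ.+-inverseˡ i) ⟨
    ω^ (ℤ.- i ℤ.+ i) · 𝟏     ≡⟨ ω^-+ (ℤ.- i) i 𝟏 ⟩
    ω^ (ℤ.- i) · ω^ i · 𝟏    ≡⟨ cong (ω^ (ℤ.- i) ·_) eq ⟩
    ω^ (ℤ.- i) · 𝟎           ≡⟨ ω^-𝟎 (ℤ.- i) ⟩
    𝟎                        ∎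

ω^-*3 : ∀ i v → ω^ (i ℤ.* + 3) · v ≡ v
ω^-*3 (+ zero)     v = refl
ω^-*3 (+ suc k)    v = trans (ω³≡id _) (trans (cong (ω^_· v) (ℤ.pos-* k 3)) (ω^-*3 (+ k) v))
-- Each negative unit unfolds to ω², so the exponent -3 unfolds to ω⁶ and two cubes are cancelled.
ω^-*3 -[1+ zero ]  v = trans (ω³≡id _) (ω³≡id v)
ω^-*3 -[1+ suc k ] v = trans (ω³≡id _) (trans (ω³≡id _) (ω^-*3 -[1+ k ] v))

-- Here `suc n` is the side of the board. Removing cubes of ω reduces the exponent to 0, which the
-- hypothesis excludes, or to 1 or 2, where only `𝟎` is fixed. The hypothesis survives each
-- reduction because `%` computes through three successors.
ω^[n-1]-fixed : ∀ n v → suc n % 3 ≢ 1 → ω^ + n · v ≡ v → v ≡ 𝟎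
ω^[n-1]-fixed 0 v n≢1 _ = contradiction refl n≢1
ω^[n-1]-fixed 1 v _ eq = ω-fixed v eq
ω^[n-1]-fixed 2 v _ eq = ω²-fixed v eq
ω^[n-1]-fixed (suc (suc (suc n))) v n≢1 eq = ω^[n-1]-fixed n v n≢1 (trans (sym (ω³≡id _)) eq)

-- Finite sums in F₄

module _ {A : Set} where

  Σ : List A → (A → F₄) → F₄
  Σ xs f = foldr _⊕_ 𝟎 (map f xs)

  Σ-cong : ∀ {f g} xs → (∀ a → f a ≡ g a) → Σ xs f ≡ Σ xs g
  Σ-cong xs f≗g = cong (foldr _⊕_ 𝟎) (map-cong f≗g xs)

  Σ-↭ : ∀ f {xs ys} → xs ↭ ys → Σ xs f ≡ Σ ys f
  Σ-↭ f p = ↭ₛ.foldr-commMonoid (setoid F₄) ⊕-isCommutativeMonoid (↭⇒↭ₛ (↭.map⁺ f p))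

  Σ-⊕ : ∀ xs f g → Σ xs f ⊕ Σ xs g ≡ Σ xs (λ a → f a ⊕ g a)
  Σ-⊕ []       f g = refl
  Σ-⊕ (a ∷ xs) f g = trans (interchange (f a) _ (g a) _) (cong (f a ⊕ g a ⊕_) (Σ-⊕ xs f g))

  Σ-ω^ : ∀ i xs f → Σ xs (λ a → ω^ i · f a) ≡ ω^ i · Σ xs f
  Σ-ω^ i []       f = sym (ω^-𝟎 i)
  Σ-ω^ i (a ∷ xs) f = trans (cong (ω^ i · f a ⊕_) (Σ-ω^ i xs f)) (sym (ω^-⊕ i (f a) _))

  unique∧set⇒↭ : ∀ {xs ys : List A} → Unique xs → Unique ys →
    (∀ {a} → a ∈ xs → a ∈ ys) → (∀ {a} → a ∈ ys → a ∈ xs) → xs ↭ ys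
  unique∧set⇒↭ xs! ys! xs⊆ys ys⊆xs = ∼bag⇒↭ (unique∧set⇒bag xs! ys! (mk⇔ xs⊆ys ys⊆xs))

  module _ (_≟_ : DecidableEquality A) where
    open DecMembership _≟_ using (_∈?_; _∉_)

    Σ-filter : ∀ f ys → (∀ a → a ∉ ys → f a ≡ 𝟎) → ∀ xs → Σ (filter (_∈? ys) xs) f ≡ Σ xs f
    Σ-filter f ys f≡𝟎 [] = refl
    Σ-filter f ys f≡𝟎 (a ∷ xs) with a ∈? ys
    ... | yes _   = cong (f a ⊕_) (Σ-filter f ys f≡𝟎 xs)
    ... | no a∉ys = trans (Σ-filter f ys f≡𝟎 xs) (cong (_⊕ Σ xs f) (sym (f≡𝟎 a a∉ys)))

    -- Discarding the entries outside `ys` removes only zero summands, and the remaining list is a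
    -- permutation of `ys`, both being duplicate-free with the same members.
    Σ-support : ∀ f {xs ys} → Unique xs → (∀ a → a ∈ xs) → Unique ys →
      (∀ a → a ∉ ys → f a ≡ 𝟎) → Σ xs f ≡ Σ ys f
    Σ-support f {xs} {ys} xs! ∈xs ys! f≡𝟎 =
      trans (sym (Σ-filter f ys f≡𝟎 xs)) (Σ-↭ f (unique∧set⇒↭ (filter⁺ (_∈? ys) xs!) ys!
        (proj₂ ∘ ∈-filter⁻ (_∈? ys) {xs = xs}) (λ {a} → ∈-filter⁺ (_∈? ys) (∈xs a))))

-- The board

hole-≡ : ∀ {n} {g h : Hole n} → Hole.x g ≡ Hole.x h → Hole.y g ≡ Hole.y h → g ≡ h
hole-≡ refl refl = refl

infix 4 _≟_

_≟_ : ∀ {n} → DecidableEquality (Hole n)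
g ≟ h = map′ (λ (p , q) → hole-≡ p q) (λ eq → cong Hole.x eq , cong Hole.y eq)
  ((Hole.x g ℤ.≟ Hole.x h) ×-dec (Hole.y g ℤ.≟ Hole.y h))

-- This makes `r ∘ r` the inverse of `r`, which yields both injectivity and a preimage for every
-- hole.
r³≡id : ∀ {n} (h : Hole n) → r (r (r h)) ≡ h
r³≡id {n} h = hole-≡ (x-coord (+ n) (Hole.x h) (Hole.y h)) (y-coord (+ n) (Hole.x h) (Hole.y h))
  where
  x-coord : ∀ n x y → (n ℤ.- 1ℤ ℤ.- (y ℤ.- x)) ℤ.- (n ℤ.- 1ℤ ℤ.- x ℤ.- (y ℤ.- x)) ≡ x
  x-coord = solve-∀
  y-coord : ∀ n x y → n ℤ.- 1ℤ ℤ.- (n ℤ.- 1ℤ ℤ.- x ℤ.- (y ℤ.- x)) ≡ y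
  y-coord = solve-∀

r-injective : ∀ {n} {g h : Hole n} → r g ≡ r h → g ≡ h
r-injective {g = g} {h} eq = trans (sym (r³≡id g)) (trans (cong (r ∘ r) eq) (r³≡id h))

-- Weights along lines and under rotation

weight : ∀ {n} → Hole n → F₄
weight h = ω^ (Hole.x h ℤ.+ Hole.y h) · 𝟏

weight-step : ∀ {n} (g h : Hole n) k d → coords g ≡ step k d (coords h) →
  weight g ≡ ω^ (k ℤ.* (proj₁ (vector d) ℤ.+ proj₂ (vector d))) · weight h
weight-step g h k d eq = trans
  (cong (ω^_· 𝟏) (trans (cong (λ (x , y) → x ℤ.+ y) eq)
    (regroup k (Hole.x h) (Hole.y h) (proj₁ (vector d)) (proj₂ (vector d)))))
  (ω^-+ (k ℤ.* (proj₁ (vector d) ℤ.+ proj₂ (vector d))) (Hole.x h ℤ.+ Hole.y h) 𝟏)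
  where
  regroup : ∀ k x y u v → (x ℤ.+ k ℤ.* u) ℤ.+ (y ℤ.+ k ℤ.* v) ≡ k ℤ.* (u ℤ.+ v) ℤ.+ (x ℤ.+ y)
  regroup = solve-∀

-- The new coordinate sum is (n - 1) + (x + y) - 3x, and the last term contributes only cubes of ω.
weight-r : ∀ {n} (h : Hole n) → weight (r h) ≡ ω^ (+ n ℤ.- 1ℤ) · weight h
weight-r {n} h = begin
  ω^ (y ℤ.- x ℤ.+ (N ℤ.- x)) · 𝟏                      ≡⟨ cong (ω^_· 𝟏) (regroup N x y) ⟩
  ω^ (N ℤ.+ ((x ℤ.+ y) ℤ.+ (ℤ.- x) ℤ.* + 3)) · 𝟏      ≡⟨ ω^-+ N _ 𝟏 ⟩
  ω^ N · ω^ ((x ℤ.+ y) ℤ.+ (ℤ.- x) ℤ.* + 3) · 𝟏       ≡⟨ cong (ω^ N ·_) (ω^-+ (x ℤ.+ y) _ 𝟏) ⟩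
  ω^ N · ω^ (x ℤ.+ y) · ω^ ((ℤ.- x) ℤ.* + 3) · 𝟏      ≡⟨ cong (λ v → ω^ N · ω^ (x ℤ.+ y) · v) (ω^-*3 (ℤ.- x) 𝟏) ⟩
  ω^ N · weight h                                     ∎
  where
  x y N : ℤ
  x = Hole.x h
  y = Hole.y h
  N = + n ℤ.- 1ℤ
  regroup : ∀ N x y → y ℤ.- x ℤ.+ (N ℤ.- x) ≡ N ℤ.+ ((x ℤ.+ y) ℤ.+ (ℤ.- x) ℤ.* + 3)
  regroup = solve-∀

-- The coordinate sum of a direction is 1, -1, 2 or -2, never a multiple of 3, so the factor is ω or
-- ω². This serves to separate the first two holes of a jump.
ω^direction-fixed : ∀ d v →
  ω^ (+ 1 ℤ.* (proj₁ (vector d) ℤ.+ proj₂ (vector d))) · v ≡ v → v ≡ 𝟎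
ω^direction-fixed +x  v eq = ω-fixed v eq
ω^direction-fixed -x  v eq = ω²-fixed v eq
ω^direction-fixed +y  v eq = ω-fixed v eq
ω^direction-fixed -y  v eq = ω²-fixed v eq
ω^direction-fixed +xy v eq = ω²-fixed v eq
ω^direction-fixed -xy v eq = ω-fixed v (trans (sym (ω³≡id _)) eq)

ω^line-sum : ∀ d v →
  v ⊕ (ω^ (+ 1 ℤ.* (proj₁ (vector d) ℤ.+ proj₂ (vector d))) · v ⊕
       ω^ (+ 2 ℤ.* (proj₁ (vector d) ℤ.+ proj₂ (vector d))) · v) ≡ 𝟎
ω^line-sum +x  v = 1+ω+ω²≡𝟎 v
ω^line-sum -x  v = 1+ω²+ω⁴≡𝟎 v
ω^line-sum +y  v = 1+ω+ω²≡𝟎 v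
ω^line-sum -y  v = 1+ω²+ω⁴≡𝟎 v
ω^line-sum +xy v = 1+ω²+ω⁴≡𝟎 v
-- The exponents -2 and -4 unfold to ω⁴ and ω⁸, which reduce to ω and ω².
ω^line-sum -xy v =
  trans (cong (v ⊕_) (cong₂ _⊕_ (ω³≡id (ω· v)) (trans (ω³≡id _) (ω³≡id (ω· (ω· v)))))) (1+ω+ω²≡𝟎 v)

-- Enumeration of the holes

module _ {m : ℕ} where

  triangleHole : (k : Fin (suc m)) → Fin (suc (toℕ k)) → Hole (suc m)
  triangleHole k j = hole (+ toℕ j) (+ toℕ k) (+≤+ z≤n) (+≤+ (toℕ≤pred[n] j)) (+≤+ (toℕ≤pred[n] k))

  triangle : List (Hole (suc m))
  triangle = concatMap (λ k → map (triangleHole k) (allFin _)) (allFin _)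

  triangleHole∈triangle : ∀ k j → triangleHole k j ∈ triangle
  triangleHole∈triangle k j = ∈-concatMap⁺ (λ k → map (triangleHole k) (allFin _))
    (lose (∈-allFin k) (∈-map⁺ (triangleHole k) (∈-allFin j)))

  -- The type of the column index depends on the row `k`. Keeping `k` general lets the equation for
  -- `b` be matched, so that the bound `x≤y` directly bounds the column index.
  ∈-triangle-row : ∀ {a b} (k : Fin (suc m)) → toℕ k ≡ b →
    .(0≤x : 0ℤ ℤ.≤ + a) .(x≤y : + a ℤ.≤ + b) .(y≤n-1 : + b ℤ.≤ + m) →
    hole (+ a) (+ b) 0≤x x≤y y≤n-1 ∈ triangle
  ∈-triangle-row k refl _ x≤y _ =
    subst (_∈ triangle) (hole-≡ (cong +_ (toℕ-fromℕ< (s≤s (ℤ.drop‿+≤+ x≤y)))) refl)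
      (triangleHole∈triangle k (fromℕ< (s≤s (ℤ.drop‿+≤+ x≤y))))

  ∈-triangle : ∀ h → h ∈ triangle
  ∈-triangle (hole (+ _) (+ _) 0≤x x≤y y≤n-1) =
    ∈-triangle-row (fromℕ< (s≤s (ℤ.drop‿+≤+ y≤n-1))) (toℕ-fromℕ< (s≤s (ℤ.drop‿+≤+ y≤n-1)))
      0≤x x≤y y≤n-1
  -- The bounds of a hole are irrelevant, so their absurdity can be used only through `⊥-elim-irr`.
  ∈-triangle (hole (+ _) -[1+ _ ] _ x≤y _) = ⊥-elim-irr (case-neg x≤y)
    where
    case-neg : ∀ {a b} → ¬ (+ a ℤ.≤ -[1+ b ])
    case-neg ()
  ∈-triangle (hole -[1+ _ ] _ 0≤x _ _) = ⊥-elim-irr (case-neg 0≤x)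
    where
    case-neg : ∀ {a} → ¬ (0ℤ ℤ.≤ -[1+ a ])
    case-neg ()

  holes : List (Hole (suc m))
  holes = deduplicate _≟_ triangle

  holes-unique : Unique holes
  holes-unique = DecUnique.deduplicate-! _≟_ triangle

  ∈-holes : ∀ h → h ∈ holes
  ∈-holes h = ∈-deduplicate⁺ _≟_ (∈-triangle h)

  map-r-holes : map r holes ↭ holes
  map-r-holes = unique∧set⇒↭ (map⁺ r-injective holes-unique) holes-unique
    (λ {h} _ → ∈-holes h)
    (λ {h} _ → subst (_∈ map r holes) (r³≡id h) (∈-map⁺ r (∈-holes (r (r h)))))

  -- Mass

  pegWeight : Position (suc m) → Hole (suc m) → F₄
  pegWeight P h = if P h then weight h else 𝟎

  mass : Position (suc m) → F₄
  mass P = Σ holes (pegWeight P)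

  -- In characteristic 2 it suffices that the two masses add up to `𝟎`. Off the line the summands
  -- cancel; each hole on it has a peg in exactly one of the two positions, so what remains is the
  -- sum of the three weights.
  mass-jump : ∀ {P Q} → Jump P Q → mass P ≡ mass Q
  mass-jump {P} {Q} J = u⊕v≡𝟎⇒u≡v (mass P) (mass Q) (begin
    mass P ⊕ mass Q                 ≡⟨ Σ-⊕ holes (pegWeight P) (pegWeight Q) ⟩
    Σ holes change                  ≡⟨ Σ-support _≟_ change holes-unique ∈-holes line-unique change-off-line ⟩
    Σ line change                   ≡⟨ cong₂ _⊕_ change-from (cong₂ _⊕_ change-over (cong (_⊕ 𝟎) change-to)) ⟩
    wf ⊕ (weight over ⊕ (weight to ⊕ 𝟎))
      ≡⟨ cong (wf ⊕_) (cong₂ _⊕_ over-weight (trans (⊕-identityʳ _) (weight-step to from (+ 2) direction to-coords))) ⟩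
    wf ⊕ (ω^ (+ 1 ℤ.* s) · wf ⊕ ω^ (+ 2 ℤ.* s) · wf) ≡⟨ ω^line-sum direction wf ⟩
    𝟎                               ∎)
    where
    open Jump J
    wf : F₄
    wf = weight from
    s : ℤ
    s = proj₁ (vector direction) ℤ.+ proj₂ (vector direction)
    change : Hole (suc m) → F₄
    change h = pegWeight P h ⊕ pegWeight Q h
    line : List (Hole (suc m))
    line = from ∷ over ∷ to ∷ []
    over-weight : weight over ≡ ω^ (+ 1 ℤ.* s) · wf
    over-weight = weight-step over from (+ 1) direction over-coords
    -- If the holes coincided, the factor of the direction would fix the weight, which is nonzero.
    from≢over : from ≢ over
    from≢over eq = ω^-nonzero (Hole.x from ℤ.+ Hole.y from)
      (ω^direction-fixed direction wf (trans (sym over-weight) (cong weight (sym eq))))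
    peg≢to : ∀ {h} → Peg P h → h ≢ to
    peg≢to peg refl = contradiction (trans (sym peg) to-before) λ ()
    line-unique : Unique line
    line-unique = (from≢over ∷ peg≢to from-before ∷ []) ∷ (peg≢to over-before ∷ []) ∷ [] ∷ []
    change-from : change from ≡ wf
    change-from rewrite from-before | from-after = ⊕-identityʳ _
    change-over : change over ≡ weight over
    change-over rewrite over-before | over-after = ⊕-identityʳ _
    change-to : change to ≡ weight to
    change-to rewrite to-before | to-after = refl
    change-off-line : ∀ h → ¬ h ∈ line → change h ≡ 𝟎
    change-off-line h h∉
      rewrite elsewhere h (h∉ ∘ here) (h∉ ∘ there ∘ here) (h∉ ∘ there ∘ there ∘ here) = ⊕-self (pegWeight P h)

  mass-jumps : ∀ l (P : Fin (suc l) → Position (suc m)) → IsJumpSequence l P →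
    ∀ i → mass (P i) ≡ mass (P (fromℕ l))
  mass-jumps zero    P J zero    = refl
  mass-jumps (suc l) P J zero    = trans (mass-jump (J zero)) (mass-jumps l (P ∘ suc) (J ∘ suc) zero)
  mass-jumps (suc l) P J (suc i) = mass-jumps l (P ∘ suc) (J ∘ suc) i

  -- The support of `pegWeight P` is a single hole, so the mass is one power of ω.
  mass-one-peg : ∀ {P} → ExactlyOnePeg P → mass P ≢ 𝟎
  mass-one-peg {P} (h , peg , only) mass≡𝟎 = ω^-nonzero (Hole.x h ℤ.+ Hole.y h) (begin
    weight h             ≡⟨ cong (if_then weight h else 𝟎) peg ⟨
    pegWeight P h        ≡⟨ ⊕-identityʳ _ ⟨
    Σ (h ∷ []) (pegWeight P)
      ≡⟨ Σ-support _≟_ (pegWeight P) holes-unique ∈-holes ([] ∷ []) no-weight ⟨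
    mass P               ≡⟨ mass≡𝟎 ⟩
    𝟎                    ∎)
    where
    no-weight : ∀ g → ¬ g ∈ h ∷ [] → pegWeight P g ≡ 𝟎
    no-weight g g∉ with P g in eq
    ... | false = refl
    ... | true  = contradiction (here (sym (only eq))) g∉

  -- The sum of `pegWeight P ∘ r` is evaluated twice: symmetry and `weight-r` extract the factor
  -- ω^m, where m is the side minus 1, while reindexing along the bijection `r` returns the mass
  -- itself.
  mass-symmetric : ∀ {P} → RotationallySymmetric P → ω^ + m · mass P ≡ mass P
  mass-symmetric {P} symm = begin
    ω^ + m · mass P                          ≡⟨ Σ-ω^ (+ m) holes (pegWeight P) ⟨
    Σ holes (λ h → ω^ + m · pegWeight P h)   ≡⟨ Σ-cong holes rotated ⟨
    Σ holes (pegWeight P ∘ r)                ≡⟨ cong (foldr _⊕_ 𝟎) (map-∘ {g = pegWeight P} {f = r} holes) ⟩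
    Σ (map r holes) (pegWeight P)            ≡⟨ Σ-↭ (pegWeight P) map-r-holes ⟩
    mass P                                   ∎
    where
    rotated : ∀ h → pegWeight P (r h) ≡ ω^ + m · pegWeight P h
    rotated h rewrite symm h with P h
    ... | true  = weight-r h
    ... | false = sym (ω^-𝟎 (+ m))

theorem2p3 : ∀ (n : ℕ) → 1 ≤ n → n % 3 ≢ 1 →
    ∀ (m : ℕ) (P : Fin (suc m) → Position n) →
    IsJumpSequence m P → ExactlyOnePeg (P (fromℕ m)) →
    ∀ (i : Fin (suc m)) → ¬ RotationallySymmetric (P i)
theorem2p3 (suc n) _ n≢1 m P jumps one i symm =
  -- Symmetry at stage `i` forces mass `𝟎` there, and invariance carries it to the final position.
  mass-one-peg {P = P (fromℕ m)} one (trans (sym (mass-jumps m P jumps i))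
    (ω^[n-1]-fixed n (mass (P i)) n≢1 (mass-symmetric {P = P i} symm)))
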